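{- For every positive integer $t\le 22$, every graph $G$ on $4t-1$ vertices with $\alpha(G)=2$ satisfies $\mathrm{cm}(G)\ge t$.
   Context: All graphs are finite and simple. $\alpha(G)$ is the independence number. A matching $M$ in $G$ is connected if for every two edges of $M$ there is an edge of $G$ joining an endpoint of one to an endpoint of the other; $\mathrm{cm}(G)$ is the maximum size of a connected matching in $G$. -}

module Defs where

open import Level using (0ℓ)
open import Data.Nat.Base using (ℕ; zero; suc; _≤_; s≤s⁻¹)
open import Data.Nat.Properties as ℕ using (m≤n⇒m<n∨m≡n)
open import Data.Fin.Base using (Fin; zero; suc)
open import Data.Fin.Properties using (_≟_; any?; all?; injective⇒≤)
open import Data.Fin.Subset using (Subset; _∈_; ∣_∣) renaming (⊥ to ∅)
open import Data.Fin.Subset.Properties using (_∈?_; anySubset?; ∣p∣≤n; ∣⊥∣≡0; ∉⊥)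
open import Data.List.Base using (List; []; _∷_; length; lookup)
open import Data.List.Membership.Propositional.Properties using (∈-lookup)
open import Data.List.Relation.Unary.All as All using (All; [])
open import Data.List.Relation.Unary.AllPairs as AllPairs using (AllPairs; []; _∷_)
open import Data.Product.Base using (∃; ∃-syntax; _×_; _,_; proj₁; proj₂)
open import Data.Sum.Base using (_⊎_; inj₁; inj₂)
open import Relation.Binary.Core using (Rel)
open import Relation.Binary.Definitions using (Symmetric; Irreflexive; Decidable)
open import Relation.Binary.PropositionalEquality as ≡ using (_≡_; refl; cong)
open import Relation.Nullary using (¬_; Dec; yes; no; contradiction)
open import Relation.Nullary.Decidable using (_×-dec_; _⊎-dec_; _→-dec_; ¬?; map′)
import Relation.Unary as U

-- A finite graph is given by its set of edges, so adjacency is decidable.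

record Graph (n : ℕ) : Set₁ where
  field
    Adj    : Rel (Fin n) 0ℓ
    sym    : Symmetric Adj
    irrefl : Irreflexive _≡_ Adj
    adj?   : Decidable Adj

IsMaximum : (ℕ → Set) → ℕ → Set
IsMaximum P m = P m × (∀ k → P k → k ≤ m)

bounded⇒maximum : {P : ℕ → Set} → U.Decidable P → P 0 →
                  ∀ b → (∀ k → P k → k ≤ b) → ∃ (IsMaximum P)
bounded⇒maximum     P? P0 zero    ub = 0 , P0 , ub
bounded⇒maximum {P} P? P0 (suc b) ub with P? (suc b)
... | yes Pb = suc b , Pb , ub
... | no ¬Pb = bounded⇒maximum P? P0 b ub′
  where
  ub′ : ∀ k → P k → k ≤ b
  ub′ k Pk with m≤n⇒m<n∨m≡n (ub k Pk)
  ... | inj₁ k<1+b = s≤s⁻¹ k<1+b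
  ... | inj₂ refl  = contradiction Pk ¬Pb

-- A pair (a , b) stands for the edge ab.  The orientation is immaterial: all
-- notions below depend on a pair only through adjacency and its endpoints.

Pair : ℕ → Set
Pair n = Fin n × Fin n

EndpointOf : ∀ {n} → Pair n → Fin n → Set
EndpointOf (a , b) v = v ≡ a ⊎ v ≡ b

endpointOf? : ∀ {n} (e : Pair n) → U.Decidable (EndpointOf e)
endpointOf? (a , b) v = (v ≟ a) ⊎-dec (v ≟ b)

Disjoint : ∀ {n} → Rel (Pair n) 0ℓ
Disjoint e f = ∀ v → EndpointOf e v → ¬ EndpointOf f v

disjoint? : ∀ {n} → Decidable (Disjoint {n})
disjoint? e f = all? λ v → endpointOf? e v →-dec ¬? (endpointOf? f v)

any-of-length? : ∀ {n} {P : List (Pair n) → Set} → U.Decidable P →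
                 ∀ k → Dec (∃[ es ] P es × length es ≡ k)
any-of-length? P? zero =
  map′ (λ p → [] , p , refl) (λ { ([] , p , refl) → p }) (P? [])
any-of-length? P? (suc k) =
  map′ (λ { (a , b , es , p , refl) → (a , b) ∷ es , p , refl })
       (λ { ((a , b) ∷ es , p , refl) → a , b , es , p , refl })
       (any? λ a → any? λ b → any-of-length? (λ es → P? ((a , b) ∷ es)) k)

firstEndpoint-injective :
  ∀ {n} {es : List (Pair n)} → AllPairs Disjoint es →
  ∀ i j → proj₁ (lookup es i) ≡ proj₁ (lookup es j) → i ≡ j
firstEndpoint-injective (_ ∷ _)  zero    zero    _  = refl
firstEndpoint-injective (d ∷ _)  zero    (suc j) eq =
  contradiction (inj₁ eq) (All.lookup d (∈-lookup j) _ (inj₁ refl))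
firstEndpoint-injective (d ∷ _)  (suc i) zero    eq =
  contradiction (inj₁ (≡.sym eq)) (All.lookup d (∈-lookup i) _ (inj₁ refl))
firstEndpoint-injective (_ ∷ ds) (suc i) (suc j) eq =
  cong suc (firstEndpoint-injective ds i j eq)

module _ {n : ℕ} (G : Graph n) where
  open Graph G

  IsIndependent : Subset n → Set
  IsIndependent S = ∀ u v → u ∈ S → v ∈ S → ¬ Adj u v

  HasIndependentSet : ℕ → Set
  HasIndependentSet k = ∃[ S ] IsIndependent S × ∣ S ∣ ≡ k

  IsEdge : Pair n → Set
  IsEdge (a , b) = Adj a b

  Joined : Rel (Pair n) 0ℓ
  Joined e f = ∃[ u ] ∃[ v ] EndpointOf e u × EndpointOf f v × Adj u v

  -- Pairwise disjointness rules out repetitions, so the length of the list is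
  -- the number of edges of the matching.
  IsMatching : List (Pair n) → Set
  IsMatching M = All IsEdge M × AllPairs Disjoint M

  -- Joined is symmetric because Adj is, so the order of the list is irrelevant.
  IsConnectedMatching : List (Pair n) → Set
  IsConnectedMatching M = IsMatching M × AllPairs Joined M

  HasConnectedMatching : ℕ → Set
  HasConnectedMatching k = ∃[ M ] IsConnectedMatching M × length M ≡ k

  isIndependent? : U.Decidable IsIndependent
  isIndependent? S =
    all? λ u → all? λ v → (u ∈? S) →-dec ((v ∈? S) →-dec ¬? (adj? u v))

  hasIndependentSet? : U.Decidable HasIndependentSet
  hasIndependentSet? k = anySubset? λ S → isIndependent? S ×-dec (∣ S ∣ ℕ.≟ k)

  hasIndependentSet⇒≤ : ∀ k → HasIndependentSet k → k ≤ n
  hasIndependentSet⇒≤ _ (S , _ , refl) = ∣p∣≤n S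

  joined? : Decidable Joined
  joined? e f =
    any? λ u → any? λ v → endpointOf? e u ×-dec endpointOf? f v ×-dec adj? u v

  isConnectedMatching? : U.Decidable IsConnectedMatching
  isConnectedMatching? M =
    (All.all? (λ (a , b) → adj? a b) M ×-dec AllPairs.allPairs? disjoint? M)
    ×-dec AllPairs.allPairs? joined? M

  hasConnectedMatching⇒≤ : ∀ k → HasConnectedMatching k → k ≤ n
  hasConnectedMatching⇒≤ _ (M , ((_ , disjoint) , _) , refl) =
    injective⇒≤ (firstEndpoint-injective disjoint _ _)

  maximumIndependentSet : ∃ (IsMaximum HasIndependentSet)
  maximumIndependentSet = bounded⇒maximum hasIndependentSet?
    (∅ , (λ _ _ u∈∅ → contradiction u∈∅ ∉⊥) , ∣⊥∣≡0 n) n hasIndependentSet⇒≤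

  maximumConnectedMatching : ∃ (IsMaximum HasConnectedMatching)
  maximumConnectedMatching = bounded⇒maximum (any-of-length? isConnectedMatching?)
    ([] , (([] , []) , []) , refl) n hasConnectedMatching⇒≤

  α : ℕ
  α = proj₁ maximumIndependentSet

  cm : ℕ
  cm = proj₁ maximumConnectedMatching

  α-isMaximum : IsMaximum HasIndependentSet α
  α-isMaximum = proj₂ maximumIndependentSet

  cm-isMaximum : IsMaximum HasConnectedMatching cm
  cm-isMaximum = proj₂ maximumConnectedMatching

{-# OPTIONS --safe #-}
-- Work in the complement of G, which is triangle-free, so that every set of
-- non-neighbours of a vertex is a clique of G; "degree" and "codegree" refer to
-- the complement.  Induct on t, over all sets S of at least 4t - 1 vertices.
--
-- If an edge uv of G has codegree at most 3, delete u, v and all but one of their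
-- common non-neighbours; every edge of the remaining graph is joined to uv.
--
-- Otherwise let v have maximum degree D, with non-neighbours K.  If D ≥ t, then t
-- vertices of K can be matched greedily.  If D = t - s with s > 0, pick s vertices
-- p outside K in a common clique, match each to a q outside K such that pq has
-- small codegree, and then match K greedily while avoiding the common
-- non-neighbours of all the pairs pq.  Averaging the codegrees, which are all at
-- least 4, gives D(D + 3) ≥ 4(|S| - 1) and shows that enough vertices q exist
-- for all the D and s that remain.
module Submission where

open import Defs
open import Data.Nat.Base
open import Data.Nat.Properties hiding (_≟_)
open import Data.Nat.ListAction using (sum)
open import Data.Nat.Tactic.RingSolver using (solve-∀)
open import Data.Fin.Base using (Fin)
open import Data.Fin.Properties using (_≟_)
open import Data.Fin.Subset using (Subset; ⁅_⁆; _∪_; ∣_∣) renaming (_∈_ to _∈ₛ_; _∉_ to _∉ₛ_)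
open import Data.Fin.Subset.Properties using
  (x∈⁅x⁆; x∈⁅y⁆⇒x≡y; ∣⁅x⁆∣≡1; x∈p∪q⁻; p⊆p∪q; q⊆p∪q; p⊂q⇒∣p∣<∣q∣)
open import Data.List.Base using (List; []; _∷_; length; map; filter; take; drop; _++_; concatMap)
open import Data.List.Properties using
  (filter-idem; filter-≐; filter-none; length-++; length-map; length-take; length-drop; length-tabulate)
open import Data.List.Extrema.Nat using (argmax; argmax-sel; f[⊥]≤f[argmax]; f[xs]≤f[argmax])
open import Data.List.Membership.Propositional using (_∈_; _∉_; lose; find)
open import Data.List.Membership.Propositional.Properties using
  (∈-filter⁺; ∈-filter⁻; ∈-++⁺ˡ; ∈-++⁺ʳ; ∈-concatMap⁺)
open import Data.List.Relation.Unary.All as All using (All; []; _∷_)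
import Data.List.Relation.Unary.All.Properties as All
open import Data.List.Relation.Unary.Any using (here; there; any?)
open import Data.List.Relation.Unary.AllPairs as AllPairs using (AllPairs; []; _∷_)
import Data.List.Relation.Unary.AllPairs.Properties as AllPairs
open import Data.List.Relation.Unary.Unique.Propositional using (Unique)
import Data.List.Relation.Unary.Unique.Propositional.Properties as Unique
open import Data.Product.Base using (∃; _×_; _,_; proj₁; proj₂)
open import Data.Sum.Base using (_⊎_; inj₁; inj₂; [_,_]′)
open import Function.Base using (_∘_)
open import Relation.Binary.PropositionalEquality
open import Relation.Nullary using (¬_; Dec; yes; no; contradiction)
open import Relation.Nullary.Decidable using (_×-dec_; _→-dec_; ¬?; decidable-stable; from-yes)
open import Relation.Unary using (Decidable)

-- Sums over lists and double counting

private variable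
  A B : Set

0<length⇒∃∈ : ∀ {xs : List A} → 0 < length xs → ∃ λ x → x ∈ xs
0<length⇒∃∈ {xs = x ∷ _} _ = x , here refl

maximiser : ∀ (f : A → ℕ) {xs} → 0 < length xs → ∃ λ x → x ∈ xs × (∀ {y} → y ∈ xs → f y ≤ f x)
maximiser f {x ∷ xs} _ =
  argmax f x xs , [ here , there ]′ (argmax-sel f x xs) ,
  λ { (here refl)  → f[⊥]≤f[argmax] {f = f} x xs
    ; (there y∈xs) → All.lookup (f[xs]≤f[argmax] {f = f} x xs) y∈xs }

length-concatMap-≤ : ∀ (f : A → List B) {c M} →
  All (λ e → length (f e) ≤ c) M → length (concatMap f M) ≤ length M * c
length-concatMap-≤ f [] = z≤n
length-concatMap-≤ f {M = e ∷ M} (small ∷ smalls) =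
  ≤-trans (≤-reflexive (length-++ (f e))) (+-mono-≤ small (length-concatMap-≤ f smalls))

∑ : List A → (A → ℕ) → ℕ
∑ xs f = sum (map f xs)

∑-mono-≤ : ∀ (xs : List A) {f g} → (∀ x → x ∈ xs → f x ≤ g x) → ∑ xs f ≤ ∑ xs g
∑-mono-≤ []       f≤g = z≤n
∑-mono-≤ (x ∷ xs) f≤g =
  +-mono-≤ (f≤g x (here refl)) (∑-mono-≤ xs λ y y∈xs → f≤g y (there y∈xs))

∑-cong : ∀ (xs : List A) {f g} → (∀ x → f x ≡ g x) → ∑ xs f ≡ ∑ xs g
∑-cong []       f≡g = refl
∑-cong (x ∷ xs) f≡g = cong₂ _+_ (f≡g x) (∑-cong xs f≡g)

∑-+ : ∀ (xs : List A) f g → ∑ xs (λ x → f x + g x) ≡ ∑ xs f + ∑ xs g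
∑-+ []       f g = refl
∑-+ (x ∷ xs) f g rewrite ∑-+ xs f g = interchange (f x) (g x) (∑ xs f) (∑ xs g)
  where
  interchange : ∀ a b c d → a + b + (c + d) ≡ a + c + (b + d)
  interchange = solve-∀

∑-const : ∀ (xs : List A) k → ∑ xs (λ _ → k) ≡ k * length xs
∑-const []       k = sym (*-zeroʳ k)
∑-const (x ∷ xs) k = trans (cong (k +_) (∑-const xs k)) (sym (*-suc k (length xs)))

∑-* : ∀ (xs : List A) k f → ∑ xs (λ x → k * f x) ≡ k * ∑ xs f
∑-* []       k f = sym (*-zeroʳ k)
∑-* (x ∷ xs) k f = trans (cong (k * f x +_) (∑-* xs k f)) (sym (*-distribˡ-+ k (f x) (∑ xs f)))

∑-swap : ∀ (xs : List A) (ys : List B) (f : A → B → ℕ) →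
         ∑ xs (λ x → ∑ ys (f x)) ≡ ∑ ys (λ y → ∑ xs (λ x → f x y))
∑-swap []       ys f = sym (∑-const ys 0)
∑-swap (x ∷ xs) ys f = trans (cong (∑ ys (f x) +_) (∑-swap xs ys f))
                             (sym (∑-+ ys (f x) (λ y → ∑ xs (λ x → f x y))))

f[x]≤∑ : ∀ {xs : List A} f {x} → x ∈ xs → f x ≤ ∑ xs f
f[x]≤∑ f (here refl)  = m≤m+n _ _
f[x]≤∑ f (there x∈xs) = m≤n⇒m≤o+n _ (f[x]≤∑ f x∈xs)

⟦_⟧ : {P : Set} → Dec P → ℕ
⟦ yes _ ⟧ = 1
⟦ no  _ ⟧ = 0

⟦⟧-yes : {P : Set} (P? : Dec P) → P → ⟦ P? ⟧ ≡ 1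
⟦⟧-yes (yes _) _ = refl
⟦⟧-yes (no ¬p) p = contradiction p ¬p

length-filter≡∑ : ∀ {P : A → Set} (P? : Decidable P) xs →
                  length (filter P? xs) ≡ ∑ xs (λ x → ⟦ P? x ⟧)
length-filter≡∑ P? [] = refl
length-filter≡∑ P? (x ∷ xs) with P? x
... | yes _ = cong suc (length-filter≡∑ P? xs)
... | no  _ = length-filter≡∑ P? xs

-- Double counting: both lengths are sums of indicators, so the order of summation can be exchanged.
∑-length-filter-swap : ∀ {R : A → B → Set} (R? : ∀ x y → Dec (R x y)) xs ys →
  ∑ xs (λ x → length (filter (R? x) ys)) ≡ ∑ ys (λ y → length (filter (λ x → R? x y) xs))
∑-length-filter-swap R? xs ys = begin
  ∑ xs (λ x → length (filter (R? x) ys))        ≡⟨ ∑-cong xs (λ x → length-filter≡∑ (R? x) ys) ⟩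
  ∑ xs (λ x → ∑ ys (λ y → ⟦ R? x y ⟧))          ≡⟨ ∑-swap xs ys (λ x y → ⟦ R? x y ⟧) ⟩
  ∑ ys (λ y → ∑ xs (λ x → ⟦ R? x y ⟧))          ≡⟨ ∑-cong ys (λ y → length-filter≡∑ (λ x → R? x y) xs) ⟨
  ∑ ys (λ y → length (filter (λ x → R? x y) xs)) ∎
  where open ≡-Reasoning

-- Counting in duplicate-free vertex lists

module _ {n : ℕ} where

  open import Data.List.Membership.DecPropositional (_≟_ {n}) using (_∈?_; _∉?_) public

  ∑-≟≤1 : ∀ {S : List (Fin n)} → Unique S → ∀ x → ∑ S (λ y → ⟦ y ≟ x ⟧) ≤ 1
  ∑-≟≤1 {[]}    []      x = z≤n
  ∑-≟≤1 {z ∷ S} (z∉S ∷ S!) x with z ≟ x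
  ... | no  _    = ∑-≟≤1 S! x
  ... | yes refl = s≤s (≤-trans (∑-mono-≤ S zero-off-z) (≤-reflexive (∑-const S 0)))
    where
    zero-off-z : ∀ y → y ∈ S → ⟦ y ≟ z ⟧ ≤ 0
    zero-off-z y y∈S with y ≟ z
    ... | no  _    = z≤n
    ... | yes refl = contradiction refl (All.lookup z∉S y∈S)

  ∑-∈≤length : ∀ {S : List (Fin n)} → Unique S → ∀ X → ∑ S (λ y → ⟦ y ∈? X ⟧) ≤ length X
  ∑-∈≤length {S} S! []      = ≤-reflexive (∑-const S 0)
  ∑-∈≤length {S} S! (x ∷ X) = begin
    ∑ S (λ y → ⟦ y ∈? (x ∷ X) ⟧)                  ≤⟨ ∑-mono-≤ S (λ y _ → split y) ⟩
    ∑ S (λ y → ⟦ y ≟ x ⟧ + ⟦ y ∈? X ⟧)             ≡⟨ ∑-+ S _ _ ⟩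
    ∑ S (λ y → ⟦ y ≟ x ⟧) + ∑ S (λ y → ⟦ y ∈? X ⟧) ≤⟨ +-mono-≤ (∑-≟≤1 S! x) (∑-∈≤length S! X) ⟩
    suc (length X) ∎
    where
    open ≤-Reasoning
    split : ∀ y → ⟦ y ∈? (x ∷ X) ⟧ ≤ ⟦ y ≟ x ⟧ + ⟦ y ∈? X ⟧
    split y with y ∈? (x ∷ X)
    ... | no  _           = z≤n
    ... | yes (here y≡x)  = ≤-trans (≤-reflexive (sym (⟦⟧-yes (y ≟ x) y≡x))) (m≤m+n _ _)
    ... | yes (there y∈X) = m≤n⇒m≤o+n _ (≤-reflexive (sym (⟦⟧-yes (y ∈? X) y∈X)))

  -- Union bound: every `y` in `S` contributes to one of the two counts. Since `S` is
  -- duplicate-free, `X` contributes at most its length, even if it has repetitions or entries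
  -- outside `S`.
  covered⇒length≤ : ∀ {P : Fin n → Set} (P? : Decidable P) {S} → Unique S → ∀ X →
    (∀ y → y ∈ S → y ∉ X → P y) → length S ≤ length (filter P? S) + length X
  covered⇒length≤ P? {S} S! X cover = begin
    length S                                        ≡⟨ *-identityˡ _ ⟨
    1 * length S                                    ≡⟨ ∑-const S 1 ⟨
    ∑ S (λ _ → 1)                                   ≤⟨ ∑-mono-≤ S one ⟩
    ∑ S (λ y → ⟦ P? y ⟧ + ⟦ y ∈? X ⟧)               ≡⟨ ∑-+ S _ _ ⟩
    ∑ S (λ y → ⟦ P? y ⟧) + ∑ S (λ y → ⟦ y ∈? X ⟧)   ≤⟨ +-mono-≤ (≤-reflexive (sym (length-filter≡∑ P? S))) (∑-∈≤length S! X) ⟩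
    length (filter P? S) + length X ∎
    where
    open ≤-Reasoning
    one : ∀ y → y ∈ S → 1 ≤ ⟦ P? y ⟧ + ⟦ y ∈? X ⟧
    one y y∈S with y ∈? X
    ... | yes _  = m≤n+m 1 _
    ... | no y∉X = ≤-trans (≤-reflexive (sym (⟦⟧-yes (P? y) (cover y y∈S y∉X)))) (m≤m+n _ _)

  -- Pigeonhole by exhaustive search: a failed search would make `covered⇒length≤` contradict the
  -- size bound.
  fresh : ∀ {P : Fin n → Set} (P? : Decidable P) {S} → Unique S → ∀ X →
    length (filter P? S) + length X < length S → ∃ λ y → y ∈ S × y ∉ X × ¬ P y
  fresh P? {S} S! X small with any? (λ y → (y ∉? X) ×-dec ¬? (P? y)) S
  ... | yes found = let y , y∈S , y∉X , ¬Py = find found in y , y∈S , y∉X , ¬Py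
  ... | no none   = contradiction
    (covered⇒length≤ P? S! X λ y y∈S y∉X →
      decidable-stable (P? y) λ ¬Py → none (lose y∈S (y∉X , ¬Py)))
    (<⇒≱ small)

-- Arithmetic of the small-degree case, and greedy choice of partners

-- s unmatched edges must be found besides a clique of D vertices; 3 + c bounds
-- the codegree allowed to each of them.
Admissible : ℕ → ℕ → ℕ → Set
Admissible D s c =
  s * (3 + c) < D + s + s ×
  D * (D + (3 + c)) + ((4 + c) + (4 + c) + c * (D + s + s)) < (4 + c) * (4 * (D + s)) + c

admissible? : ∀ D s c → Dec (Admissible D s c)
admissible? D s c = (_ <? _) ×-dec (_ <? _)

-- With larger bounds this would first fail at D = 21 and s = 7.
admissible : ∀ {D} → D < 23 → ∀ {s} → s < 23 →
  0 < s × D + s < 23 × 4 * (4 * (D + s)) ≤ D * (D + 3) + 8 →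
  0 < D × pred s * (D + 3) + 8 < 4 * (4 * (D + s)) × ∃ λ c → c < 23 × Admissible D s c
admissible = from-yes (allUpTo? (λ D → allUpTo? (λ s →
  ((0 <? s) ×-dec (D + s <? 23) ×-dec (4 * (4 * (D + s)) ≤? D * (D + 3) + 8)) →-dec
  ((0 <? D) ×-dec (pred s * (D + 3) + 8 <? 4 * (4 * (D + s))) ×-dec anyUpTo? (admissible? D s) 23)) 23) 23)

-- When a partner is chosen, the list to avoid consists of `X` and the partners chosen before, which
-- are fewer than `length xs`; hence the bound under which `choose` must succeed. In the recursion
-- `x` leaves `xs` and `y` enters `X`, so the bound stays the same.
greedyPairs : ∀ {A : Set} {R : A → A → Set} xs X →
  (∀ {x} → x ∈ xs → ∀ X′ → length X′ < length X + length xs → ∃ λ y → y ∉ X′ × R x y) →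
  ∃ λ M → map proj₁ M ≡ xs × Unique (map proj₂ M) ×
          All (λ (x , y) → x ∈ xs × y ∉ X × R x y) M
greedyPairs []       X choose = [] , refl , [] , []
greedyPairs {R = R} (x ∷ xs) X choose
  with y , y∉X , Rxy ← choose (here refl) X
         (m<m+n (length X) z<s)
  with M , refl , seconds! , good ← greedyPairs {R = R} xs (y ∷ X) (λ x∈xs X′ X′< →
         choose (there x∈xs) X′ (subst (length X′ <_) (sym (+-suc (length X) (length xs))) X′<))
  = (x , y) ∷ M , refl
  , All.map⁺ (All.map (λ (_ , y′∉y∷X , _) y≡y′ → y′∉y∷X (here (sym y≡y′))) good) ∷ seconds!
  , (here refl , y∉X , Rxy)
    ∷ All.map (λ (x∈xs , y′∉y∷X , Rxy′) → there x∈xs , y′∉y∷X ∘ there , Rxy′) good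

-- The complement, and connected matchings built on a clique

module _ {n : ℕ} (G : Graph n) where
  open Graph G renaming (sym to Adj-sym)

  NonAdj : Fin n → Fin n → Set
  NonAdj u v = u ≢ v × ¬ Adj u v

  nonAdj? : ∀ u v → Dec (NonAdj u v)
  nonAdj? u v = ¬? (u ≟ v) ×-dec ¬? (adj? u v)

  NonAdj-sym : ∀ {u v} → NonAdj u v → NonAdj v u
  NonAdj-sym (u≢v , ¬uv) = ≢-sym u≢v , ¬uv ∘ Adj-sym

  ¬NonAdj⇒Adj : ∀ {u v} → u ≢ v → ¬ NonAdj u v → Adj u v
  ¬NonAdj⇒Adj {u} {v} u≢v ¬nonAdj = decidable-stable (adj? u v) λ ¬uv → ¬nonAdj (u≢v , ¬uv)

  Adj⇒≢ : ∀ {u v} → Adj u v → u ≢ v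
  Adj⇒≢ uv u≡v = irrefl u≡v uv

  -- A triangle of the complement would be an independent set of three vertices.
  α≤2⇒complementTriangleFree : α G ≤ 2 →
    ∀ {u v w} → NonAdj u v → NonAdj u w → ¬ NonAdj v w
  α≤2⇒complementTriangleFree α≤2 {u} {v} {w} (u≢v , ¬uv) (u≢w , ¬uw) (v≢w , ¬vw) =
    <⇒≱ (<-≤-trans 2<∣T∣ (proj₂ (α-isMaximum G) _ (T , T-independent , refl))) α≤2
    where
    P T : Subset n
    P = ⁅ u ⁆ ∪ ⁅ v ⁆
    T = P ∪ ⁅ w ⁆

    w∉P : w ∉ₛ P
    w∉P w∈P = [ ≢-sym u≢w ∘ x∈⁅y⁆⇒x≡y u , ≢-sym v≢w ∘ x∈⁅y⁆⇒x≡y v ]′ (x∈p∪q⁻ ⁅ u ⁆ ⁅ v ⁆ w∈P)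

    -- The cardinality is bounded along the strict inclusions of `⁅ u ⁆` in `P` and of `P` in `T`.
    2<∣T∣ : 2 < ∣ T ∣
    2<∣T∣ = begin-strict
      2              ≡⟨ cong suc (∣⁅x⁆∣≡1 u) ⟨
      suc ∣ ⁅ u ⁆ ∣  ≤⟨ p⊂q⇒∣p∣<∣q∣ (p⊆p∪q ⁅ v ⁆ , v , q⊆p∪q ⁅ u ⁆ ⁅ v ⁆ (x∈⁅x⁆ v) , ≢-sym u≢v ∘ x∈⁅y⁆⇒x≡y u) ⟩
      ∣ P ∣          <⟨ p⊂q⇒∣p∣<∣q∣ (p⊆p∪q ⁅ w ⁆ , w , q⊆p∪q P ⁅ w ⁆ (x∈⁅x⁆ w) , w∉P) ⟩
      ∣ T ∣          ∎
      where open ≤-Reasoning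

    members : ∀ {x} → x ∈ₛ T → x ≡ u ⊎ x ≡ v ⊎ x ≡ w
    members x∈T with x∈p∪q⁻ P ⁅ w ⁆ x∈T
    ... | inj₂ x∈w = inj₂ (inj₂ (x∈⁅y⁆⇒x≡y w x∈w))
    ... | inj₁ x∈P with x∈p∪q⁻ ⁅ u ⁆ ⁅ v ⁆ x∈P
    ...   | inj₁ x∈u = inj₁ (x∈⁅y⁆⇒x≡y u x∈u)
    ...   | inj₂ x∈v = inj₂ (inj₁ (x∈⁅y⁆⇒x≡y v x∈v))

    T-independent : IsIndependent G T
    T-independent x y x∈T y∈T xy with members x∈T | members y∈T
    ... | inj₁ refl        | inj₁ refl        = irrefl refl xy
    ... | inj₁ refl        | inj₂ (inj₁ refl) = ¬uv xy
    ... | inj₁ refl        | inj₂ (inj₂ refl) = ¬uw xy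
    ... | inj₂ (inj₁ refl) | inj₁ refl        = ¬uv (Adj-sym xy)
    ... | inj₂ (inj₁ refl) | inj₂ (inj₁ refl) = irrefl refl xy
    ... | inj₂ (inj₁ refl) | inj₂ (inj₂ refl) = ¬vw xy
    ... | inj₂ (inj₂ refl) | inj₁ refl        = ¬uw (Adj-sym xy)
    ... | inj₂ (inj₂ refl) | inj₂ (inj₁ refl) = ¬vw (Adj-sym xy)
    ... | inj₂ (inj₂ refl) | inj₂ (inj₂ refl) = irrefl refl xy

  -- Any two edges are joined through their first endpoints. They are disjoint because adjacent
  -- first endpoints differ, second endpoints are distinct, and `K` separates the first endpoints
  -- from the second.
  cliqueMatching : ∀ {K} M → AllPairs Adj (map proj₁ M) → Unique (map proj₂ M) →
    All (λ (x , y) → x ∈ K × y ∉ K × Adj x y) M → IsConnectedMatching G M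
  cliqueMatching {K} M clique seconds! good =
    (All.map (proj₂ ∘ proj₂) good , AllPairs.map proj₁ pairs) , AllPairs.map proj₂ pairs
    where
    pairUp : ∀ M → AllPairs Adj (map proj₁ M) → Unique (map proj₂ M) →
             All (λ (x , y) → x ∈ K × y ∉ K × Adj x y) M →
             AllPairs (λ e f → Disjoint e f × Joined G e f) M
    pairUp []            _  _  _ = []
    pairUp ((x , y) ∷ M) (x~ ∷ cl) (y≢ ∷ !) ((x∈K , y∉K , _) ∷ good) =
      All.zipWith (λ { (xx′ , y≢y′ , x′∈K , y′∉K , _) →
          (λ { _ (inj₁ refl) (inj₁ refl) → irrefl refl xx′
             ; _ (inj₁ refl) (inj₂ refl) → y′∉K x∈K
             ; _ (inj₂ refl) (inj₁ refl) → y∉K x′∈K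
             ; _ (inj₂ refl) (inj₂ refl) → y≢y′ refl })
        , _ , _ , inj₁ refl , inj₁ refl , xx′ })
        (All.map⁻ x~ , All.zip (All.map⁻ y≢ , good))
      ∷ pairUp M cl ! good

    pairs = pairUp M clique seconds! good

  -- The induction deletes vertices. Keeping `G` fixed and confining the endpoints to a list avoids
  -- renumbering the vertices of a subgraph.
  HasConnectedMatchingIn : List (Fin n) → ℕ → Set
  HasConnectedMatchingIn S k =
    ∃ λ M → IsConnectedMatching G M × All (λ (a , b) → a ∈ S × b ∈ S) M × length M ≡ k

  nonNbrs : List (Fin n) → Fin n → List (Fin n)
  nonNbrs S u = filter (nonAdj? u) S

  -- Filtering twice turns the sum of the codegrees over all `v` into a double count between
  -- `nonNbrs S u` and `S`, and makes the codegree of `u` with itself equal to its degree.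
  commonNonNbrs : List (Fin n) → Fin n → Fin n → List (Fin n)
  commonNonNbrs S u v = nonNbrs (nonNbrs S u) v

  ∈-common⁺ : ∀ {S u v w} → w ∈ S → NonAdj u w → NonAdj v w → w ∈ commonNonNbrs S u v
  ∈-common⁺ w∈S uw vw = ∈-filter⁺ (nonAdj? _) (∈-filter⁺ (nonAdj? _) w∈S uw) vw

  module _ {S : List (Fin n)} (S! : Unique S) where

    -- Deleting an edge of small codegree

    -- An edge is joined to every edge that does not lie among its common
    -- non-neighbours, so all of these but one are deleted.
    addEdge : ∀ {t u v} → u ∈ S → v ∈ S → Adj u v → length (commonNonNbrs S u v) ≤ 3 →
      4 * suc t ≤ suc (length S) →
      (∀ {S′} → Unique S′ → 4 * t ≤ suc (length S′) → HasConnectedMatchingIn S′ t) →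
      HasConnectedMatchingIn S (suc t)
    addEdge {t} {u} {v} u∈S v∈S uv small 4t≤ recurse =
      let M , ((edges , disj) , join) , M⊆S′ , ∣M∣≡t =
            recurse (Unique.filter⁺ (_∉? X) S!) 4t≤′
      in (u , v) ∷ M
      , ((uv ∷ edges
         , All.map (λ (a∈S′ , b∈S′) → disjoint a∈S′ b∈S′) M⊆S′ ∷ disj)
        , All.zipWith (λ (ab , a∈S′ , b∈S′) → joined a∈S′ b∈S′ (Adj⇒≢ ab)) (edges , M⊆S′) ∷ join)
      , (u∈S , v∈S) ∷ All.map (λ (a∈S′ , b∈S′) → S′⊆S a∈S′ , S′⊆S b∈S′) M⊆S′
      , cong suc ∣M∣≡t
      where
      C = commonNonNbrs S u v
      X = u ∷ v ∷ drop 1 C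
      S′ = filter (_∉? X) S

      S′⊆S : ∀ {x} → x ∈ S′ → x ∈ S
      S′⊆S = proj₁ ∘ ∈-filter⁻ (_∉? X)

      S′∌X : ∀ {x} → x ∈ S′ → x ∉ X
      S′∌X x∈S′ = proj₂ (∈-filter⁻ (_∉? X) {xs = S} x∈S′)

      -- `X` has at most 1 + 1 + (3 - 1) = 4 entries, exactly the amount by which the required size
      -- drops from `suc t` to `t`.
      4t≤′ : 4 * t ≤ suc (length S′)
      4t≤′ = +-cancelˡ-≤ 4 _ _ (begin
        4 + 4 * t                       ≡⟨ *-suc 4 t ⟨
        4 * suc t                       ≤⟨ 4t≤ ⟩
        suc (length S)                  ≤⟨ s≤s (covered⇒length≤ (_∉? X) S! X λ _ _ y∉X → y∉X) ⟩
        suc (length S′ + length X)      ≤⟨ s≤s (+-monoʳ-≤ (length S′) ∣X∣≤4) ⟩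
        suc (length S′ + 4)             ≡⟨ +-comm (suc (length S′)) 4 ⟩
        4 + suc (length S′)             ∎)
        where
        open ≤-Reasoning
        ∣X∣≤4 : length X ≤ 4
        ∣X∣≤4 = s≤s (s≤s (≤-trans (≤-reflexive (length-drop 1 C)) (∸-monoˡ-≤ 1 small)))

      disjoint : ∀ {a b} → a ∈ S′ → b ∈ S′ → Disjoint (u , v) (a , b)
      disjoint a∈S′ b∈S′ _ (inj₁ refl) (inj₁ refl) = S′∌X a∈S′ (here refl)
      disjoint a∈S′ b∈S′ _ (inj₁ refl) (inj₂ refl) = S′∌X b∈S′ (here refl)
      disjoint a∈S′ b∈S′ _ (inj₂ refl) (inj₁ refl) = S′∌X a∈S′ (there (here refl))
      disjoint a∈S′ b∈S′ _ (inj₂ refl) (inj₂ refl) = S′∌X b∈S′ (there (here refl))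

      subsingleton : ∀ {A : Set} {x y : A} xs → x ∈ xs → y ∈ xs →
        x ∉ drop 1 xs → y ∉ drop 1 xs → x ≡ y
      subsingleton _ (here refl) (here refl) _ _ = refl
      subsingleton _ (there x∈) _ x∉ _ = contradiction x∈ x∉
      subsingleton _ _ (there y∈) _ y∉ = contradiction y∈ y∉

      attach : ∀ {a} → a ∈ S′ → a ∉ C → ∃ λ x → EndpointOf (u , v) x × Adj x a
      attach {a} a∈S′ a∉C with nonAdj? u a
      ... | no ¬ua = u , inj₁ refl , ¬NonAdj⇒Adj (λ { refl → S′∌X a∈S′ (here refl) }) ¬ua
      ... | yes ua = v , inj₂ refl , ¬NonAdj⇒Adj (λ { refl → S′∌X a∈S′ (there (here refl)) })
                       (a∉C ∘ ∈-common⁺ (S′⊆S a∈S′) ua)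

      joined : ∀ {a b} → a ∈ S′ → b ∈ S′ → a ≢ b → Joined G (u , v) (a , b)
      joined {a} {b} a∈S′ b∈S′ a≢b
        with a ∈? C | b ∈? C
      -- Only the head of `C` can survive in `S′`, so two distinct vertices of `S′` are not both in
      -- `C`.
      ... | yes a∈C | yes b∈C = contradiction
              (subsingleton C a∈C b∈C (S′∌X a∈S′ ∘ there ∘ there) (S′∌X b∈S′ ∘ there ∘ there)) a≢b
      ... | no a∉C | _ = let x , x∈uv , xa = attach a∈S′ a∉C in x , a , x∈uv , inj₁ refl , xa
      ... | _ | no b∉C = let x , x∈uv , xb = attach b∈S′ b∉C in x , b , x∈uv , inj₂ refl , xb

    -- Averaging codegrees

    -- Count the paths p – w – q of the complement through all q ∈ S: there are at
    -- most d · D of them, and the trivial ones with q = p account for d.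
    codegree-average : ∀ {p} D c X → p ∈ S →
      (∀ {w} → w ∈ S → length (nonNbrs S w) ≤ D) →
      (∀ {q} → q ∈ S → Adj p q → 4 ≤ length (commonNonNbrs S p q)) →
      (∀ {q} → q ∈ S → Adj p q → q ∉ X → 4 + c ≤ length (commonNonNbrs S p q)) →
      (4 + c) * length S ≤ length (nonNbrs S p) * (D + (3 + c)) + ((4 + c) + c * length X)
    codegree-average {p} D c X p∈S maxDegree codegree≥4 codegree≥ = +-cancelʳ-≤ d _ _ (begin
      k * length S + d                                    ≤⟨ +-mono-≤ (≤-reflexive (sym (∑-const S k))) d≤ ⟩
      ∑ S (λ _ → k) + ∑ S (λ q → d * ⟦ q ≟ p ⟧)           ≡⟨ ∑-+ S _ _ ⟨
      ∑ S (λ q → k + d * ⟦ q ≟ p ⟧)                       ≤⟨ ∑-mono-≤ S pointwise ⟩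
      ∑ S (λ q → codegree q + (k * ⟦ nonAdj? p q ⟧ + (k * ⟦ q ≟ p ⟧ + c * ⟦ q ∈? X ⟧)))
        ≡⟨ trans (∑-+ S _ _) (cong (∑ S codegree +_) (trans (∑-+ S _ _)
             (cong₂ _+_ (∑-* S k _) (trans (∑-+ S _ _) (cong₂ _+_ (∑-* S k _) (∑-* S c _)))))) ⟩
      ∑ S codegree + (k * ∑ S (λ q → ⟦ nonAdj? p q ⟧) +
        (k * ∑ S (λ q → ⟦ q ≟ p ⟧) + c * ∑ S (λ q → ⟦ q ∈? X ⟧)))
        ≤⟨ +-mono-≤ paths (+-mono-≤ (≤-reflexive (cong (k *_) (sym (length-filter≡∑ (nonAdj? p) S))))
             (+-mono-≤ (*-monoʳ-≤ k (∑-≟≤1 S! p)) (*-monoʳ-≤ c (∑-∈≤length S! X)))) ⟩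
      D * d + (k * d + (k * 1 + c * length X))            ≡⟨ rearrange D d c (length X) ⟩
      d * (D + (3 + c)) + (k + c * length X) + d          ∎)
      where
      open ≤-Reasoning
      d = length (nonNbrs S p)
      k = 4 + c

      codegree : Fin n → ℕ
      codegree q = length (commonNonNbrs S p q)

      rearrange : ∀ D d c x → D * d + ((4 + c) * d + ((4 + c) * 1 + c * x)) ≡
                              d * (D + (3 + c)) + ((4 + c) + c * x) + d
      rearrange = solve-∀

      d≤ : d ≤ ∑ S (λ q → d * ⟦ q ≟ p ⟧)
      d≤ = ≤-trans (≤-reflexive (sym (trans (cong (d *_) (⟦⟧-yes (p ≟ p) refl)) (*-identityʳ d))))
                   (f[x]≤∑ (λ q → d * ⟦ q ≟ p ⟧) p∈S)

      paths : ∑ S codegree ≤ D * d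
      paths = begin
        ∑ S codegree
          ≡⟨ ∑-length-filter-swap nonAdj? S (nonNbrs S p) ⟩
        ∑ (nonNbrs S p) (λ w → length (filter (λ q → nonAdj? q w) S))
          ≡⟨ ∑-cong (nonNbrs S p) (λ w → cong length (filter-≐ (λ q → nonAdj? q w) (nonAdj? w) (NonAdj-sym , NonAdj-sym) S)) ⟩
        ∑ (nonNbrs S p) (λ w → length (nonNbrs S w))
          ≤⟨ ∑-mono-≤ (nonNbrs S p) (λ w w∈ → maxDegree (proj₁ (∈-filter⁻ (nonAdj? p) w∈))) ⟩
        ∑ (nonNbrs S p) (λ _ → D)
          ≡⟨ ∑-const (nonNbrs S p) D ⟩
        D * d ∎

      -- The right side makes up for the `q` whose codegree may fall below `k`: it adds `k` for a
      -- non-neighbour of `p`, `c` for `q` in `X`, where only codegree 4 is guaranteed, and `k` for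
      -- `p` itself, whose codegree `d` pays for the extra term on the left.
      pointwise : ∀ q → q ∈ S → k + d * ⟦ q ≟ p ⟧ ≤
        codegree q + (k * ⟦ nonAdj? p q ⟧ + (k * ⟦ q ≟ p ⟧ + c * ⟦ q ∈? X ⟧))
      pointwise q q∈S with q ≟ p
      ... | yes refl = begin
        k + d * 1                                            ≡⟨ swap k d ⟩
        d + (k * 1 + 0)                                      ≤⟨ +-mono-≤ (≤-reflexive (cong length (sym (filter-idem (nonAdj? p) S))))
                                                                   (≤-trans (+-monoʳ-≤ (k * 1) z≤n) (m≤n+m _ _)) ⟩
        codegree p + (k * ⟦ nonAdj? p p ⟧ + (k * 1 + c * ⟦ p ∈? X ⟧)) ∎
        where
        swap : ∀ k d → k + d * 1 ≡ d + (k * 1 + 0)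
        swap = solve-∀
      ... | no q≢p with nonAdj? p q
      ...   | yes _ = begin
        k + d * 0                                      ≡⟨ drop-0 k d ⟩
        k * 1                                          ≤⟨ m≤m+n _ _ ⟩
        k * 1 + (k * 0 + c * ⟦ q ∈? X ⟧)               ≤⟨ m≤n+m _ _ ⟩
        codegree q + (k * 1 + (k * 0 + c * ⟦ q ∈? X ⟧)) ∎
        where
        drop-0 : ∀ k d → k + d * 0 ≡ k * 1
        drop-0 = solve-∀
      ...   | no ¬pq with q ∈? X
      ...     | yes _ = begin
        4 + c + d * 0                          ≡⟨ regroup c d ⟩
        4 + (k * 0 + (k * 0 + c * 1))          ≤⟨ +-monoˡ-≤ _ (codegree≥4 q∈S pq) ⟩
        codegree q + (k * 0 + (k * 0 + c * 1)) ∎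
        where
        pq = ¬NonAdj⇒Adj (≢-sym q≢p) ¬pq
        regroup : ∀ c d → 4 + c + d * 0 ≡ 4 + ((4 + c) * 0 + ((4 + c) * 0 + c * 1))
        regroup = solve-∀
      ...     | no q∉X = begin
        k + d * 0                              ≡⟨ drop-0 k d ⟩
        k                                      ≤⟨ codegree≥ q∈S (¬NonAdj⇒Adj (≢-sym q≢p) ¬pq) q∉X ⟩
        codegree q                             ≤⟨ m≤m+n _ _ ⟩
        codegree q + (k * 0 + (k * 0 + c * 0)) ∎
        where
        drop-0 : ∀ k d → k + d * 0 ≡ k
        drop-0 = solve-∀

    -- Extending a connected matching by a clique

    blocked : Pair n → List (Fin n)
    blocked (a , b) = a ∷ b ∷ commonNonNbrs S a b

    -- The clique K is matched greedily to vertices y outside all sets blocked e;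
    -- then y alone joins the new edge to every edge e of M.
    extendByClique : ∀ {K M} D c → AllPairs Adj K → (∀ {x} → x ∈ K → x ∈ S) →
      (∀ {x} → x ∈ K → length (nonNbrs S x) ≤ D) →
      IsConnectedMatching G M → All (λ (a , b) → a ∈ S × b ∈ S) M →
      All (λ (a , b) → a ∉ K × b ∉ K) M →
      All (λ (a , b) → length (commonNonNbrs S a b) ≤ c) M →
      D + (length K + length M * (2 + c) + length K) ≤ length S →
      HasConnectedMatchingIn S (length K + length M)
    extendByClique {K} {M} D c clique K⊆S degree≤ ((edges , disj) , join) M⊆S M∩K=∅ codegree≤ room =
      let N , firsts≡K , seconds! , good = greedyPairs {R = λ x y → y ∈ S × ¬ NonAdj x y} K X choose
          (N-edges , N-disj) , N-join = cliqueMatching N (subst (AllPairs Adj) (sym firsts≡K) clique)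
            seconds! (All.map (λ (x∈K , y∉X , _ , ¬xy) →
              let y∉K = y∉X ∘ ∈-++⁺ˡ in
              x∈K , y∉K , ¬NonAdj⇒Adj (λ { refl → y∉K x∈K }) ¬xy) good)
          cross = All.tabulate λ {e} e∈N → All.tabulate λ {f} f∈M →
            let x∈K , y∉X , y∈S , ¬xy = All.lookup good e∈N in
            separate x∈K y∈S (λ y∈blocked → y∉X (∈-++⁺ʳ K (∈-concatMap⁺ blocked (lose f∈M y∈blocked))))
                     (All.lookup M∩K=∅ f∈M)
      in N ++ M
       , ((All.++⁺ N-edges edges , AllPairs.++⁺ N-disj disj (All.map (All.map proj₁) cross))
         , AllPairs.++⁺ N-join join (All.map (All.map proj₂) cross))
       , All.++⁺ (All.map (λ (x∈K , _ , y∈S , _) → K⊆S x∈K , y∈S) good) M⊆S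
       , trans (length-++ N) (cong (_+ length M)
           (trans (sym (length-map proj₁ N)) (cong length firsts≡K)))
      where
      X = K ++ concatMap blocked M

      ∣X∣≤ : length X ≤ length K + length M * (2 + c)
      ∣X∣≤ = ≤-trans (≤-reflexive (length-++ K))
        (+-monoʳ-≤ (length K) (length-concatMap-≤ blocked (All.map (λ small → s≤s (s≤s small)) codegree≤)))

      choose : ∀ {x} → x ∈ K → ∀ X′ → length X′ < length X + length K →
               ∃ λ y → y ∉ X′ × y ∈ S × ¬ NonAdj x y
      choose {x} x∈K X′ X′< =
        -- At most `D` vertices are lost to non-adjacency with `x`, and fewer than
        -- `length X + length K` to `X` and the partners already chosen; `room` bounds this total.
        let y , y∈S , y∉X′ , ¬xy = fresh (nonAdj? x) S! X′ (begin-strict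
              length (nonNbrs S x) + length X′                        <⟨ +-mono-≤-< (degree≤ x∈K) X′< ⟩
              D + (length X + length K)                               ≤⟨ +-monoʳ-≤ D (+-monoˡ-≤ (length K) ∣X∣≤) ⟩
              D + (length K + length M * (2 + c) + length K)          ≤⟨ room ⟩
              length S                                                ∎)
        in y , y∉X′ , y∈S , ¬xy
        where open ≤-Reasoning

      -- As `y` avoids `blocked (a , b)`, it is neither `a` nor `b` and is not a non-neighbour of
      -- both, so it is adjacent to one of them.
      separate : ∀ {x y a b} → x ∈ K → y ∈ S → y ∉ blocked (a , b) → a ∉ K × b ∉ K →
        Disjoint (x , y) (a , b) × Joined G (x , y) (a , b)
      separate {x} {y} {a} {b} x∈K y∈S y∉ (a∉K , b∉K) =
        (λ { _ (inj₁ refl) (inj₁ refl) → a∉K x∈K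
           ; _ (inj₁ refl) (inj₂ refl) → b∉K x∈K
           ; _ (inj₂ refl) (inj₁ refl) → y∉ (here refl)
           ; _ (inj₂ refl) (inj₂ refl) → y∉ (there (here refl)) })
        , joined
        where
        joined : Joined G (x , y) (a , b)
        joined with nonAdj? a y
        ... | no ¬ay = y , a , inj₂ refl , inj₁ refl ,
          Adj-sym (¬NonAdj⇒Adj (λ { refl → y∉ (here refl) }) ¬ay)
        ... | yes ay = y , b , inj₂ refl , inj₂ refl ,
          Adj-sym (¬NonAdj⇒Adj (λ { refl → y∉ (there (here refl)) })
                               (y∉ ∘ there ∘ there ∘ ∈-common⁺ y∈S ay))

    -- Triangle-free complement: maximum degree at least t

    module _ (noTriangle : ∀ {u v w} → NonAdj u v → NonAdj u w → ¬ NonAdj v w) where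

      nonNbrs! : ∀ v → Unique (nonNbrs S v)
      nonNbrs! v = Unique.filter⁺ (nonAdj? v) S!

      nonNbrs⊆S : ∀ v {x} → x ∈ nonNbrs S v → x ∈ S
      nonNbrs⊆S v = proj₁ ∘ ∈-filter⁻ (nonAdj? v)

      ∈-nonNbrs⁻ : ∀ v {x} → x ∈ nonNbrs S v → NonAdj v x
      ∈-nonNbrs⁻ v x∈N = proj₂ (∈-filter⁻ (nonAdj? v) {xs = S} x∈N)

      nonNbrs-clique : ∀ v → AllPairs Adj (nonNbrs S v)
      nonNbrs-clique v = go (nonNbrs! v) (All.tabulate (∈-nonNbrs⁻ v))
        where
        go : ∀ {xs} → Unique xs → All (NonAdj v) xs → AllPairs Adj xs
        go []         []         = []
        go (x≢ ∷ xs!) (vx ∷ vxs) =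
          All.zipWith (λ (x≢y , vy) → ¬NonAdj⇒Adj x≢y (noTriangle vx vy)) (x≢ , vxs) ∷ go xs! vxs

      -- The clique of non-neighbours of `v` has room for all `2 * t` endpoints, so the partners are
      -- taken from the clique itself, where no vertex is lost to non-adjacency.
      matchLargeDegree : ∀ {t v} → 2 * t ≤ length (nonNbrs S v) → HasConnectedMatchingIn S t
      matchLargeDegree {t} {v} 2t≤ =
        let M , firsts≡K , seconds! , good = greedyPairs {R = λ x y → y ∈ N × ¬ NonAdj x y} K K choose
        in M
         , cliqueMatching M (subst (AllPairs Adj) (sym firsts≡K) (AllPairs.take⁺ t (nonNbrs-clique v)))
             seconds! (All.map (λ (x∈K , y∉K , _ , ¬xy) →
               x∈K , y∉K , ¬NonAdj⇒Adj (λ { refl → y∉K x∈K }) ¬xy) good)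
         , All.map (λ (x∈K , _ , y∈N , _) → nonNbrs⊆S v (K⊆N x∈K) , nonNbrs⊆S v y∈N) good
         , trans (sym (length-map proj₁ M)) (trans (cong length firsts≡K) ∣K∣≡t)
        where
        N = nonNbrs S v
        K = take t N

        K⊆N : ∀ {x} → x ∈ K → x ∈ N
        K⊆N = All.lookup (All.take⁺ t (All.tabulate (λ x∈N → x∈N)))

        ∣K∣≡t : length K ≡ t
        ∣K∣≡t = trans (length-take t N) (m≤n⇒m⊓n≡m (≤-trans (m≤m+n t _) 2t≤))

        choose : ∀ {x} → x ∈ K → ∀ X′ → length X′ < length K + length K →
                 ∃ λ y → y ∉ X′ × y ∈ N × ¬ NonAdj x y
        choose {x} x∈K X′ X′< =
          let y , y∈N , y∉X′ , ¬xy = fresh (nonAdj? x) (nonNbrs! v) X′ (begin-strict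
                length (filter (nonAdj? x) N) + length X′
                  ≡⟨ cong (λ xs → length xs + length X′) (filter-none (nonAdj? x)
                       (All.tabulate λ y∈N → noTriangle (∈-nonNbrs⁻ v (K⊆N x∈K)) (∈-nonNbrs⁻ v y∈N))) ⟩
                length X′            <⟨ X′< ⟩
                length K + length K  ≡⟨ cong₂ _+_ ∣K∣≡t (trans ∣K∣≡t (sym (+-identityʳ t))) ⟩
                2 * t                ≤⟨ 2t≤ ⟩
                length N             ∎)
          in y , y∉X′ , y∈N , ¬xy
          where open ≤-Reasoning

      matchMediumDegree : ∀ {t v D} → t ≤ length (nonNbrs S v) → D < 2 * t →
        (∀ {w} → w ∈ S → length (nonNbrs S w) ≤ D) → 4 * t ≤ suc (length S) →
        HasConnectedMatchingIn S t
      matchMediumDegree {t} {v} {D} t≤ D<2t maxDegree 4t≤ =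
        subst (HasConnectedMatchingIn S) (trans (+-identityʳ _) ∣K∣≡t)
          (extendByClique D 0 (AllPairs.take⁺ t (nonNbrs-clique v)) K⊆S (maxDegree ∘ K⊆S)
            (([] , []) , []) [] [] [] (s≤s⁻¹ room))
        where
        K = take t (nonNbrs S v)

        K⊆S : ∀ {x} → x ∈ K → x ∈ S
        K⊆S = All.lookup (All.take⁺ t (All.tabulate (nonNbrs⊆S v)))

        ∣K∣≡t : length K ≡ t
        ∣K∣≡t = trans (length-take t (nonNbrs S v)) (m≤n⇒m⊓n≡m t≤)

        -- A partner has to avoid at most `D` non-neighbours and fewer than `2 * t` vertices in use.
        -- The strictness of `D < 2 * t` makes up for `S` having possibly only 4t - 1 vertices.
        room : D + (length K + 0 + length K) < suc (length S)
        room = begin-strict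
          D + (length K + 0 + length K)  ≡⟨ cong (λ k → D + (k + 0 + k)) ∣K∣≡t ⟩
          D + (t + 0 + t)                <⟨ +-monoˡ-< _ D<2t ⟩
          2 * t + (t + 0 + t)            ≡⟨ double t ⟩
          4 * t                          ≤⟨ 4t≤ ⟩
          suc (length S)                 ∎
          where
          open ≤-Reasoning
          double : ∀ t → 2 * t + (t + 0 + t) ≡ 4 * t
          double = solve-∀

      -- Maximum degree D below t = D + s

      module _ {v s} (v∈S : v ∈ S)
        (maxDegree : ∀ {w} → w ∈ S → length (nonNbrs S w) ≤ length (nonNbrs S v))
        (codegree≥4 : ∀ {p q} → p ∈ S → q ∈ S → Adj p q → 4 ≤ length (commonNonNbrs S p q))
        (4t≤ : 4 * (length (nonNbrs S v) + s) ≤ suc (length S)) where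

        private
          K = nonNbrs S v
          D = length K

        -- If every neighbour of `p` outside `X` had codegree at least `4 + c`, then
        -- `codegree-average` would contradict the second inequality of `Admissible`. The bound on
        -- `X` leaves room for `K`, the `s` vertices p and fewer than `s` vertices q chosen earlier.
        lowCodegreeNbr : ∀ {p} c X → p ∈ S → length X < D + s + s → Admissible D s c →
          ∃ λ q → q ∈ S × q ∉ X × Adj p q × length (commonNonNbrs S p q) ≤ 3 + c
        lowCodegreeNbr {p} c X p∈S X< (_ , adm)
          with any? (λ q → (q ∉? X) ×-dec adj? p q ×-dec (length (commonNonNbrs S p q) ≤? 3 + c)) S
        ... | yes found = find found
        ... | no none   = contradiction adm (≤⇒≯ (begin
          (4 + c) * (4 * (D + s)) + c                              ≤⟨ +-monoˡ-≤ c (*-monoʳ-≤ (4 + c) 4t≤) ⟩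
          (4 + c) * suc (length S) + c                             ≡⟨ cong (_+ c) (*-suc (4 + c) (length S)) ⟩
          (4 + c) + (4 + c) * length S + c                         ≤⟨ +-monoˡ-≤ c (+-monoʳ-≤ (4 + c)
            (codegree-average D c X p∈S maxDegree (codegree≥4 p∈S) λ q∈S pq q∉X →
              ≰⇒> λ small → none (lose q∈S (q∉X , pq , small)))) ⟩
          (4 + c) + (d * (D + (3 + c)) + ((4 + c) + c * length X)) + c  ≡⟨ regroup c (d * (D + (3 + c))) (length X) ⟩
          d * (D + (3 + c)) + ((4 + c) + (4 + c) + c * suc (length X)) ≤⟨ +-mono-≤ (*-monoˡ-≤ (D + (3 + c)) (maxDegree p∈S))
                                                                           (+-monoʳ-≤ (4 + c + (4 + c)) (*-monoʳ-≤ c X<)) ⟩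
          D * (D + (3 + c)) + ((4 + c) + (4 + c) + c * (D + s + s)) ∎))
          where
          open ≤-Reasoning
          d = length (nonNbrs S p)
          regroup : ∀ c m x → (4 + c) + (m + ((4 + c) + c * x)) + c ≡
                              m + ((4 + c) + (4 + c) + c * suc x)
          regroup = solve-∀

        -- This is `codegree-average` with `c` = 0. For `v` it bounds `D` from below; for a vertex
        -- of `K` it yields the `s` non-neighbours that serve as the vertices p.
        degree-lower : ∀ {p} → p ∈ S → 4 * (4 * (D + s)) ≤ length (nonNbrs S p) * (D + 3) + 8
        degree-lower {p} p∈S = begin
          4 * (4 * (D + s))              ≤⟨ *-monoʳ-≤ 4 4t≤ ⟩
          4 * suc (length S)             ≡⟨ *-suc 4 (length S) ⟩
          4 + 4 * length S               ≤⟨ +-monoʳ-≤ 4 (codegree-average D 0 [] p∈S maxDegree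
                                              (codegree≥4 p∈S) (λ q∈S pq _ → codegree≥4 p∈S q∈S pq)) ⟩
          4 + (d * (D + 3) + 4)          ≡⟨ regroup (d * (D + 3)) ⟩
          d * (D + 3) + 8                ∎
          where
          open ≤-Reasoning
          d = length (nonNbrs S p)
          regroup : ∀ m → 4 + (m + 4) ≡ m + 8
          regroup = solve-∀

        -- The vertices p are non-neighbours of a `w` in `K`, hence a clique. None of them lies in
        -- `K`, as it would form a triangle of the complement with `v` and `w`.
        matchFrom : ∀ {w} c → w ∈ K → s ≤ length (nonNbrs S w) → Admissible D s c →
                    HasConnectedMatchingIn S (D + s)
        matchFrom {w} c w∈K s≤ adm =
          let M , firsts≡P , seconds! , good = greedyPairs
                {R = λ p q → q ∈ S × Adj p q × length (commonNonNbrs S p q) ≤ 3 + c} P (K ++ P) choose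
              ∣M∣≡s = trans (sym (length-map proj₁ M)) (trans (cong length firsts≡P) ∣P∣≡s)
          in subst (λ m → HasConnectedMatchingIn S (D + m)) ∣M∣≡s
            (extendByClique D (3 + c) (nonNbrs-clique v) (nonNbrs⊆S v) (maxDegree ∘ nonNbrs⊆S v)
              (cliqueMatching M (subst (AllPairs Adj) (sym firsts≡P) (AllPairs.take⁺ s (nonNbrs-clique w)))
                seconds! (All.map (λ (p∈P , q∉ , _ , pq , _) → p∈P , q∉ ∘ ∈-++⁺ʳ K , pq) good))
              (All.map (λ (p∈P , _ , q∈S , _) → nonNbrs⊆S w (P⊆N p∈P) , q∈S) good)
              (All.map (λ (p∈P , q∉ , _) → P∩K=∅ p∈P , q∉ ∘ ∈-++⁺ˡ) good)
              (All.map (λ (_ , _ , _ , _ , small) → small) good)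
              (s≤s⁻¹ (subst (λ m → D + (D + m * (5 + c) + D) < suc (length S)) (sym ∣M∣≡s) room)))
          where
          P = take s (nonNbrs S w)

          P⊆N : ∀ {x} → x ∈ P → x ∈ nonNbrs S w
          P⊆N = All.lookup (All.take⁺ s (All.tabulate (λ x∈N → x∈N)))

          ∣P∣≡s : length P ≡ s
          ∣P∣≡s = trans (length-take s (nonNbrs S w)) (m≤n⇒m⊓n≡m s≤)

          P∩K=∅ : ∀ {x} → x ∈ P → x ∉ K
          P∩K=∅ x∈P x∈K = noTriangle (∈-nonNbrs⁻ v w∈K) (∈-nonNbrs⁻ v x∈K) (∈-nonNbrs⁻ w (P⊆N x∈P))

          choose : ∀ {p} → p ∈ P → ∀ X′ → length X′ < length (K ++ P) + length P →
            ∃ λ q → q ∉ X′ × q ∈ S × Adj p q × length (commonNonNbrs S p q) ≤ 3 + c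
          choose p∈P X′ X′< =
            let q , q∈S , q∉X′ , rest = lowCodegreeNbr c X′ (nonNbrs⊆S w (P⊆N p∈P))
                  (<-≤-trans X′< (≤-reflexive (cong₂ _+_
                    (trans (length-++ K) (cong (D +_) ∣P∣≡s)) ∣P∣≡s))) adm
            in q , q∉X′ , q∈S , rest

          -- Each pair pq blocks its two endpoints and at most `3 + c` common non-neighbours; the
          -- first inequality of `Admissible` makes all of this fit into 4t - 1 vertices.
          room : D + (D + s * (5 + c) + D) < suc (length S)
          room = begin-strict
            D + (D + s * (5 + c) + D)                 ≡⟨ regroup D s c ⟩
            D + D + D + s + s + s * (3 + c)           <⟨ +-monoʳ-< (D + D + D + s + s) (proj₁ adm) ⟩
            D + D + D + s + s + (D + s + s)           ≡⟨ collect D s ⟩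
            4 * (D + s)                               ≤⟨ 4t≤ ⟩
            suc (length S)                            ∎
            where
            open ≤-Reasoning
            regroup : ∀ D s c → D + (D + s * (5 + c) + D) ≡ D + D + D + s + s + s * (3 + c)
            regroup = solve-∀
            collect : ∀ D s → D + D + D + s + s + (D + s + s) ≡ 4 * (D + s)
            collect = solve-∀

        matchSmallDegree : 0 < s → D + s < 23 → HasConnectedMatchingIn S (D + s)
        matchSmallDegree 0<s t<23 =
          let 0<D , few , c , _ , adm = admissible (≤-<-trans (m≤m+n D s) t<23)
                (≤-<-trans (m≤n+m s D) t<23) (0<s , t<23 , degree-lower v∈S)
              w , w∈K = 0<length⇒∃∈ 0<D
          -- If `w` had degree at most `pred s`, then `degree-lower` for `w` would contradict `few`.
          in matchFrom c w∈K (≮⇒≥ λ dw<s → <⇒≱ few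
               (≤-trans (degree-lower (nonNbrs⊆S v w∈K))
                        (+-monoˡ-≤ 8 (*-monoˡ-≤ (D + 3) (<⇒≤pred dw<s))))) adm

      -- Combining the cases, and the induction on t

      matchCodegree≥4 : ∀ {t v} → t ≤ 22 → 4 * t ≤ suc (length S) → v ∈ S →
        (∀ {w} → w ∈ S → length (nonNbrs S w) ≤ length (nonNbrs S v)) →
        (∀ {p q} → p ∈ S → q ∈ S → Adj p q → 4 ≤ length (commonNonNbrs S p q)) →
        HasConnectedMatchingIn S t
      matchCodegree≥4 {t} {v} t≤22 4t≤ v∈S maxDegree codegree≥4 = go (2 * t ≤? D) (t ≤? D)
        where
        D = length (nonNbrs S v)

        go : Dec (2 * t ≤ D) → Dec (t ≤ D) → HasConnectedMatchingIn S t
        go (yes 2t≤D) _         = matchLargeDegree 2t≤D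
        go (no  2t≰D) (yes t≤D) = matchMediumDegree t≤D (≰⇒> 2t≰D) maxDegree 4t≤
        go (no  _)    (no t≰D)  = subst (HasConnectedMatchingIn S) D+s≡t
          (matchSmallDegree v∈S maxDegree codegree≥4
            (subst (λ m → 4 * m ≤ suc (length S)) (sym D+s≡t) 4t≤)
            (m<n⇒0<n∸m (≰⇒> t≰D)) (subst (_< 23) (sym D+s≡t) (s≤s t≤22)))
          where
          D+s≡t : D + (t ∸ D) ≡ t
          D+s≡t = m+[n∸m]≡n (<⇒≤ (≰⇒> t≰D))

  -- `S` is arbitrary because `addEdge` passes to a smaller list. The size bound 4t - 1 is written
  -- with `suc` on the other side, free of truncated subtraction, and t at most 22 keeps `D` and `s`
  -- in the range checked by `admissible`.
  hasConnectedMatchingIn : (∀ {u v w} → NonAdj u v → NonAdj u w → ¬ NonAdj v w) →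
    ∀ t → t ≤ 22 → ∀ {S} → Unique S → 4 * t ≤ suc (length S) → HasConnectedMatchingIn S t
  hasConnectedMatchingIn noTriangle zero    _    _ _ = [] , (([] , []) , []) , [] , refl
  hasConnectedMatchingIn noTriangle (suc t) t<22 {S} S! 4t≤
    with any? (λ u → any? (λ v → adj? u v ×-dec (length (commonNonNbrs S u v) ≤? 3)) S) S
  ... | yes found =
    let u , u∈S , found′ = find found
        v , v∈S , uv , small = find found′
    in addEdge S! u∈S v∈S uv small 4t≤ (hasConnectedMatchingIn noTriangle t (<⇒≤ t<22))
  ... | no none =
    let v , v∈S , maxDegree = maximiser (λ w → length (nonNbrs S w)) nonempty
    in matchCodegree≥4 S! noTriangle t<22 4t≤ v∈S maxDegree λ p∈S q∈S pq →
         ≰⇒> λ small → none (lose p∈S (lose q∈S (pq , small)))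
    where
    nonempty : 0 < length S
    nonempty = ≤-trans (m≤n⇒m≤o+n t z<s) (s≤s⁻¹ 4t≤)

theorem1p6 : (t : ℕ) → 1 ≤ t → t ≤ 22 →
    (G : Graph (4 * t ∸ 1)) → α G ≡ 2 → cm G ≥ t
theorem1p6 t 1≤t t≤22 G α≡2 =
  let M , connected , _ , ∣M∣≡t = hasConnectedMatchingIn G
        (α≤2⇒complementTriangleFree G (≤-reflexive α≡2)) t t≤22 (Unique.allFin⁺ _)
        (≤-trans (m≤n+m∸n (4 * t) 1) (≤-reflexive (cong suc (sym (length-tabulate (λ x → x))))))
  in proj₂ (cm-isMaximum G) t (M , connected , ∣M∣≡t)
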